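{- There exists a constant $c>0$ such that for every integer $k \geq 1$ there exists an undirected graph $G$ of pathwidth at most $k$ with at most $k^{c}$ vertices such that every tropical circuit calculating $IS_G$ has $\Omega(2^k)$ gates (nodes).
   Context: For an undirected graph $G$, associate a variable $x_v$ with every vertex $v$, and let $\mathcal{I}(G)$ be the family of independent sets of $G$. $IS_G$ is the tropical $(\max,+)$ polynomial $\sum_{I \in \mathcal{I}(G)} \prod_{v\in I} x_v$; for a valuation $\nu$ (an assignment of real numbers to the variables) it evaluates to $IS_G(\nu)=\max_{I\in\mathcal{I}(G)}\sum_{v\in I}\nu(x_v)$. A tropical circuit is a directed acyclic graph whose nodes have in-degree $0$ or $2$; in-degree-$0$ nodes are labeled by a variable (input nodes) or by the constant $0$; in-degree-$2$ nodes are labeled by $+$ or $\max$; one node is designated as output. On a valuation $\nu$, an input node labeled $x$ evaluates to $\nu(x)$, a constant node to $0$, and a $+$ (resp. $\max$) node to the sum (resp. maximum) of the values of its two predecessors; the circuit's value is that of the output node. A circuit calculates a polynomial $p$ if its value equals $p(\nu)$ for every valuation $\nu$. The size (number of gates) of a circuit is its number of nodes. A path decomposition of $G$ is a sequence of bags $\beta_1,\dots,\beta_\ell\subseteq V(G)$ such that every edge lies in some bag and, for each vertex, the bags containing it form a contiguous interval; its width is $\max_i|\beta_i|-1$, and the pathwidth is the minimum width of a path decomposition. -}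

module Defs where

open import Data.Nat using (ℕ; zero; suc) renaming (_≤_ to _≤ℕ_; _<_ to _<ℕ_; _+_ to _+ℕ_)
open import Data.Fin using (Fin; zero; suc)
open import Data.Bool using (Bool; true; false; if_then_else_)
open import Data.Vec using (Vec; []; _∷_)
open import Data.Fin.Subset using (Subset; _∈_; ∣_∣)
open import Data.Rational using (ℚ; 0ℚ; _+_; _⊔_; _≤_)
open import Data.Product using (Σ; _×_; _,_)
open import Relation.Binary.PropositionalEquality using (_≡_)
open import Relation.Nullary using (¬_)

record Graph (n : ℕ) : Set₁ where
  field
    Adj       : Fin n → Fin n → Set
    symmetric : ∀ u v → Adj u v → Adj v u
    irrefl    : ∀ v → ¬ Adj v v
open Graph public

Independent : ∀ {n} → Graph n → Subset n → Set
Independent G I = ∀ u v → u ∈ I → v ∈ I → ¬ Adj G u v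

Valuation : ℕ → Set
Valuation n = Fin n → ℚ

weight : ∀ {n} → Valuation n → Subset n → ℚ
weight {zero}  ν []      = 0ℚ
weight {suc n} ν (b ∷ I) = (if b then ν zero else 0ℚ) + weight (λ i → ν (suc i)) I

IsISValue : ∀ {n} → Graph n → Valuation n → ℚ → Set
IsISValue G ν q =
  (∀ I → Independent G I → weight ν I ≤ q) ×
  Σ (Subset _) (λ I → Independent G I × weight ν I ≡ q)

record PathDecomposition {n : ℕ} (G : Graph n) : Set₁ where
  field
    len  : ℕ
    bag  : Fin len → Subset n
    edgesCovered : ∀ u v → Adj G u v → Σ (Fin len) λ i → u ∈ bag i × v ∈ bag i
    contiguous   : ∀ v (i j l : Fin len) →
                   Data.Fin._≤_ i j → Data.Fin._≤_ j l →
                   v ∈ bag i → v ∈ bag l → v ∈ bag j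
open PathDecomposition public

PathwidthAtMost : ∀ {n} → Graph n → ℕ → Set₁
PathwidthAtMost G k =
  Σ (PathDecomposition G) λ P → ∀ i → ∣ bag P i ∣ ≤ℕ suc k

-- Tropical circuits over variables x_v (v : Fin n).
-- A DAG is given in topological order: gate number m may only use
-- gates 0..m-1 as predecessors.  Predecessors are referenced by
-- Fin m, where zero = the immediately preceding gate, etc.

data Gate (n m : ℕ) : Set where
  var    : Fin n → Gate n m
  const0 : Gate n m
  plus   : Fin m → Fin m → Gate n m
  maxg   : Fin m → Fin m → Gate n m

data Circuit (n : ℕ) : ℕ → Set where
  []  : Circuit n 0
  _▷_ : ∀ {m} → Circuit n m → Gate n m → Circuit n (suc m)

evalGate : ∀ {n m} → Gate n m → Valuation n → (Fin m → ℚ) → ℚ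
evalGate (var v)    ν vals = ν v
evalGate const0     ν vals = 0ℚ
evalGate (plus a b) ν vals = vals a + vals b
evalGate (maxg a b) ν vals = vals a ⊔ vals b

-- value of every node; index zero = last node added
evalAll : ∀ {n s} → Circuit n s → Valuation n → Fin s → ℚ
evalAll (C ▷ g) ν zero    = evalGate g ν (evalAll C ν)
evalAll (C ▷ g) ν (suc i) = evalAll C ν i

Calculates : ∀ {n s} → Graph n → Circuit n s → Fin s → Set
Calculates G C out = ∀ ν → IsISValue G ν (evalAll C ν out)

{-# OPTIONS --safe #-}

-- The graph has K = k - 31 hub vertices holding bits s and 4K+1 chains of K cliques, the j-th
-- chain computing the inner product of s with a vector aⱼ mod 8. Removing the hubs leaves a
-- graph of bounded pathwidth. Every s gives an independent set. A calculating circuit formally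
-- produces exactly the monomials of IS_G, so each of these sets has a parse tree, and some plus
-- gate of it splits the final vertices of the chains into three parts (left input, right input,
-- rest), none containing more than half of them. If s ≠ s′ use the same gate, exchanging parts
-- yields independent sets again, so adjacent vertices of the two sets lie in the same part. All
-- chains whose results differ are linked to the hub of the first differing bit, hence their
-- final vertices lie in one part. The vectors aⱼ are chosen greedily such that any two bit strings
-- collide on fewer than half of the chains; this is then a contradiction, so the 2^K strings use
-- distinct gates.
module Submission where

open import Defs
open import Data.Nat using (ℕ; _≤_; _*_; _^_)
open import Data.Fin using (Fin)
open import Data.Product using (Σ; _×_)

open import Data.Nat using (zero; suc; _+_; _⊔_; _<_; z≤n; s≤s; _≤?_; _<?_) renaming (_≟_ to _≟ℕ_)
open import Data.Nat.Properties hiding (_≟_)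
open import Data.Nat.DivMod using (_mod_)
open import Data.Nat.Tactic.RingSolver using (solve-∀)
import Data.Rational as ℚ
import Data.Rational.Properties as ℚ
open import Data.Bool using (Bool; true; false; if_then_else_)
open import Data.Fin using (zero; suc; toℕ; fromℕ<; combine; remQuot; _≟_)
import Data.Fin.Properties as Fin
open import Data.Fin.Properties using
  (all?; +↔⊎; *↔×; nonZeroIndex; toℕ-injective; toℕ-fromℕ<; toℕ<n; toℕ-combine;
   remQuot-combine; combine-remQuot; injective⇒≤)
open import Data.Fin.Subset using (Subset; _∈_; ∣_∣)
open import Data.Vec using (Vec; []; _∷_; head; tail; lookup; tabulate)
open import Data.Vec.Properties using (≡-dec; []=⇒lookup; lookup⇒[]=; lookup∘tabulate)
open import Data.Product using (∃; ∃₂; _,_; proj₁; proj₂)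
import Data.Product.Properties as ×
open import Data.Product.Function.NonDependent.Propositional using (_×-↔_)
open import Data.Sum using (_⊎_; inj₁; inj₂; [_,_]′)
open import Data.Sum.Function.Propositional using (_⊎-↔_)
open import Data.Empty using (⊥; ⊥-elim)
open import Data.Unit using (⊤; tt)
open import Function using (_∘_; id; _↔_; Inverse)
open import Function.Construct.Composition using (_↔-∘_)
open import Function.Construct.Identity using (↔-id)
open import Relation.Nullary using (¬_; Dec; yes; no; does; contradiction)
open import Relation.Nullary.Decidable using (from-yes; _→-dec_; _⊎-dec_; _×-dec_; dec-true; dec-false)
open import Relation.Binary.PropositionalEquality
open import Algebra.Properties.Semiring.Sum +-*-semiring
  using (sum; sum-cong-≗; ∑-distrib-+; ∑-comm; *-distribˡ-sum)

-- Indicators and finite sums of natural numbers: monotonicity, tightness, averaging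

𝟙 : ∀ {P : Set} → Dec P → ℕ
𝟙 P? = if does P? then 1 else 0

𝟙-yes : ∀ {P : Set} (P? : Dec P) → P → 𝟙 P? ≡ 1
𝟙-yes P? p rewrite dec-true P? p = refl

𝟙-no : ∀ {P : Set} (P? : Dec P) → ¬ P → 𝟙 P? ≡ 0
𝟙-no P? ¬p rewrite dec-false P? ¬p = refl

𝟙≤1 : ∀ {P : Set} (P? : Dec P) → 𝟙 P? ≤ 1
𝟙≤1 (yes _) = s≤s z≤n
𝟙≤1 (no _)  = z≤n

∑-mono : ∀ {n} {f g : Fin n → ℕ} → (∀ i → f i ≤ g i) → sum f ≤ sum g
∑-mono {zero}  f≤g = z≤n
∑-mono {suc n} f≤g = +-mono-≤ (f≤g zero) (∑-mono (f≤g ∘ suc))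

term≤∑ : ∀ {n} (f : Fin n → ℕ) i → f i ≤ sum f
term≤∑ f zero    = m≤m+n _ _
term≤∑ f (suc i) = ≤-trans (term≤∑ (f ∘ suc) i) (m≤n+m _ (f zero))

∑-const : ∀ n c → sum {n} (λ _ → c) ≡ n * c
∑-const zero    c = refl
∑-const (suc n) c = cong (c +_) (∑-const n c)

∑-averaging : ∀ {m} (f : Fin (suc m) → ℕ) {b} → sum f ≤ suc m * b → ∃ λ i → f i ≤ b
∑-averaging {zero} f {b} ∑f≤b = zero , subst₂ _≤_ (+-identityʳ _) (+-identityʳ b) ∑f≤b
∑-averaging {suc m} f {b} ∑f≤ with f zero ≤? b
... | yes f0≤b = zero , f0≤b
... | no  f0≰b = let i , fi≤b = ∑-averaging (f ∘ suc) rest in suc i , fi≤b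
  where
  rest : sum (f ∘ suc) ≤ suc m * b
  rest = +-cancelˡ-≤ b _ _ (≤-trans (+-monoˡ-≤ _ (<⇒≤ (≰⇒> f0≰b))) ∑f≤)

∑-atMostOne : ∀ {n} {P : Fin n → Set} (P? : ∀ i → Dec (P i)) →
              (∀ i j → P i → P j → i ≡ j) → sum (λ i → 𝟙 (P? i)) ≤ 1
∑-atMostOne {zero}  P? unique = z≤n
∑-atMostOne {suc n} P? unique with P? zero
... | no _   = ∑-atMostOne (P? ∘ suc) λ i j p q → Fin.suc-injective (unique (suc i) (suc j) p q)
... | yes p₀ = s≤s (≤-reflexive (trans
  (sum-cong-≗ λ i → 𝟙-no (P? (suc i)) λ p → Fin.0≢1+n (unique zero (suc i) p₀ p))
  (trans (∑-const n 0) (*-zeroʳ n))))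

-- A strict gain in one term could not be made up elsewhere. This later turns an optimum attained by
-- a monomial into information about each single vertex.
∑-tight : ∀ {n} {f g : Fin n → ℕ} → (∀ i → f i ≤ g i) → sum g ≤ sum f → ∀ i → g i ≤ f i
∑-tight {suc n} {f} {g} f≤g ∑g≤∑f zero =
  +-cancelʳ-≤ (sum (f ∘ suc)) _ _ (≤-trans (+-monoʳ-≤ (g zero) (∑-mono (f≤g ∘ suc))) ∑g≤∑f)
∑-tight {suc n} {f} {g} f≤g ∑g≤∑f (suc i) =
  ∑-tight (f≤g ∘ suc) (+-cancelˡ-≤ (g zero) _ _ (≤-trans ∑g≤∑f (+-monoˡ-≤ _ (f≤g zero)))) i

-- The head coordinate is summed innermost, so that a hash vector can be averaged over its first
-- letter while its tail stays fixed, as the recursion of `hash` requires.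
∑ᵛ : ∀ m K → (Vec (Fin m) K → ℕ) → ℕ
∑ᵛ m zero    f = f []
∑ᵛ m (suc K) f = ∑ᵛ m K λ v → sum λ x → f (x ∷ v)

∑ᵛ-cong : ∀ m K {f g : Vec (Fin m) K → ℕ} → (∀ v → f v ≡ g v) → ∑ᵛ m K f ≡ ∑ᵛ m K g
∑ᵛ-cong m zero    f≗g = f≗g []
∑ᵛ-cong m (suc K) f≗g = ∑ᵛ-cong m K λ v → sum-cong-≗ λ x → f≗g (x ∷ v)

∑ᵛ-mono : ∀ m K {f g : Vec (Fin m) K → ℕ} → (∀ v → f v ≤ g v) → ∑ᵛ m K f ≤ ∑ᵛ m K g
∑ᵛ-mono m zero    f≤g = f≤g []
∑ᵛ-mono m (suc K) f≤g = ∑ᵛ-mono m K λ v → ∑-mono λ x → f≤g (x ∷ v)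

∑ᵛ-distrib-+ : ∀ m K (f g : Vec (Fin m) K → ℕ) → ∑ᵛ m K (λ v → f v + g v) ≡ ∑ᵛ m K f + ∑ᵛ m K g
∑ᵛ-distrib-+ m zero    f g = refl
∑ᵛ-distrib-+ m (suc K) f g =
  trans (∑ᵛ-cong m K λ v → ∑-distrib-+ (λ x → f (x ∷ v)) (λ x → g (x ∷ v)))
        (∑ᵛ-distrib-+ m K (λ v → sum λ x → f (x ∷ v)) (λ v → sum λ x → g (x ∷ v)))

*-distribˡ-∑ᵛ : ∀ m K c (f : Vec (Fin m) K → ℕ) → c * ∑ᵛ m K f ≡ ∑ᵛ m K (λ v → c * f v)
*-distribˡ-∑ᵛ m zero    c f = refl
*-distribˡ-∑ᵛ m (suc K) c f =
  trans (*-distribˡ-∑ᵛ m K c _) (∑ᵛ-cong m K λ v → *-distribˡ-sum c (λ x → f (x ∷ v)))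

∑ᵛ-const : ∀ m K c → ∑ᵛ m K (λ _ → c) ≡ m ^ K * c
∑ᵛ-const m zero    c = sym (*-identityˡ c)
∑ᵛ-const m (suc K) c = begin
  ∑ᵛ m K (λ _ → sum {m} (λ _ → c)) ≡⟨ ∑ᵛ-cong m K (λ _ → ∑-const m c) ⟩
  ∑ᵛ m K (λ _ → m * c)             ≡⟨ ∑ᵛ-const m K (m * c) ⟩
  m ^ K * (m * c)                  ≡⟨ sym (*-assoc (m ^ K) m c) ⟩
  m ^ K * m * c                    ≡⟨ cong (_* c) (*-comm (m ^ K) m) ⟩
  m ^ suc K * c                    ∎
  where open ≡-Reasoning

term≤∑ᵛ : ∀ m K (f : Vec (Fin m) K → ℕ) v → f v ≤ ∑ᵛ m K f
term≤∑ᵛ m zero    f []      = ≤-refl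
term≤∑ᵛ m (suc K) f (x ∷ v) = ≤-trans (term≤∑ (λ x → f (x ∷ v)) x) (term≤∑ᵛ m K _ v)

∑ᵛ-∑-comm : ∀ m K {n} (f : Vec (Fin m) K → Fin n → ℕ) →
            ∑ᵛ m K (λ v → sum (f v)) ≡ sum (λ i → ∑ᵛ m K (λ v → f v i))
∑ᵛ-∑-comm m zero    f = refl
∑ᵛ-∑-comm m (suc K) f =
  trans (∑ᵛ-cong m K λ v → ∑-comm (λ x → f (x ∷ v))) (∑ᵛ-∑-comm m K (λ v i → sum λ x → f (x ∷ v) i))

∑ᵛ-comm : ∀ m K m′ K′ (f : Vec (Fin m) K → Vec (Fin m′) K′ → ℕ) →
          ∑ᵛ m K (λ v → ∑ᵛ m′ K′ (f v)) ≡ ∑ᵛ m′ K′ (λ w → ∑ᵛ m K (λ v → f v w))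
∑ᵛ-comm m K m′ zero     f = refl
∑ᵛ-comm m K m′ (suc K′) f =
  trans (∑ᵛ-comm m K m′ K′ (λ v w → sum λ x → f v (x ∷ w)))
        (∑ᵛ-cong m′ K′ λ w → ∑ᵛ-∑-comm m K (λ v x → f v (x ∷ w)))

∑ᵛ-averaging : ∀ m K (f : Vec (Fin (suc m)) K → ℕ) {b} → ∑ᵛ (suc m) K f ≤ suc m ^ K * b → ∃ λ v → f v ≤ b
∑ᵛ-averaging m zero    f {b} ∑f≤ = [] , subst (f [] ≤_) (*-identityˡ b) ∑f≤
∑ᵛ-averaging m (suc K) f {b} ∑f≤ =
  let v , fv≤ = ∑ᵛ-averaging m K (λ v → sum λ x → f (x ∷ v))
                  (subst (∑ᵛ (suc m) (suc K) f ≤_) (lemma (suc m) (suc m ^ K) b) ∑f≤)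
      x , fx≤ = ∑-averaging (λ x → f (x ∷ v)) fv≤
  in x ∷ v , fx≤
  where
  lemma : ∀ x y z → x * y * z ≡ y * (x * z)
  lemma = solve-∀

^-distribʳ-* : ∀ o m n → (m * n) ^ o ≡ m ^ o * n ^ o
^-distribʳ-* zero    m n = refl
^-distribʳ-* (suc o) m n = trans (cong (m * n *_) (^-distribʳ-* o m n)) (rearrange m n (m ^ o) (n ^ o))
  where
  rearrange : ∀ a b c d → a * b * (c * d) ≡ a * c * (b * d)
  rearrange = solve-∀

-- Hash families with few agreements

step : Fin 8 → Fin 2 → Fin 8 → Fin 8
step a b x = (toℕ b * toℕ a + toℕ x) mod 8

step-injective : ∀ a b x y → step a b x ≡ step a b y → x ≡ y
step-injective = from-yes (all? λ a → all? λ b → all? λ x → all? λ y →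
                           (step a b x ≟ step a b y) →-dec (x ≟ y))

-- If the bits differ, one side is a shift by `a` and the other is constant in `a`, so exactly one
-- of the eight letters makes them equal.
step-collides-once : ∀ b b′ x y → b ≡ b′ ⊎ sum (λ a → 𝟙 (step a b x ≟ step a b′ y)) ≡ 1
step-collides-once = from-yes (all? λ b → all? λ b′ → all? λ x → all? λ y →
                               (b ≟ b′) ⊎-dec (sum (λ a → 𝟙 (step a b x ≟ step a b′ y)) ≟ℕ 1))

-- The inner product modulo 8, accumulated from the last coordinate to the first; its intermediate
-- values are what the cliques of a chain record.
hash : ∀ {K} → Vec (Fin 8) K → Vec (Fin 2) K → Fin 8
hash []      []      = zero
hash (a ∷ v) (b ∷ s) = step a b (hash v s)

_≟ᵛ_ : ∀ {m K} (v w : Vec (Fin m) K) → Dec (v ≡ w)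
_≟ᵛ_ = ≡-dec _≟_

collides : ∀ {K} → Vec (Fin 8) K → Vec (Fin 2) K → Vec (Fin 2) K → ℕ
collides v s s′ = 𝟙 (hash v s ≟ hash v s′)

𝟙-⇔ : ∀ {P Q : Set} (P? : Dec P) (Q? : Dec Q) → (P → Q) → (Q → P) → 𝟙 P? ≡ 𝟙 Q?
𝟙-⇔ P? (yes q) to from = 𝟙-yes P? (from q)
𝟙-⇔ P? (no ¬q) to from = 𝟙-no P? (¬q ∘ to)

-- The collision probability is exactly 1/8. If the heads differ, one head letter in eight gives a
-- collision, whatever the tail is; if they agree, injectivity of `step` reduces the claim to the
-- tails.
collision-count : ∀ {K} (s s′ : Vec (Fin 2) K) → s ≢ s′ → 8 * ∑ᵛ 8 K (λ v → collides v s s′) ≡ 8 ^ K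
collision-count []      []        s≢s′ = contradiction refl s≢s′
collision-count {suc K} (b ∷ s) (b′ ∷ s′) s≢s′ with b ≟ b′
... | yes refl = begin
  8 * ∑ᵛ 8 K (λ v → sum λ x → collides (x ∷ v) (b ∷ s) (b ∷ s′))
    ≡⟨ cong (8 *_) (∑ᵛ-cong 8 K λ v → trans (sum-cong-≗ (same v)) (∑-const 8 (collides v s s′))) ⟩
  8 * ∑ᵛ 8 K (λ v → 8 * collides v s s′)   ≡⟨ cong (8 *_) (sym (*-distribˡ-∑ᵛ 8 K 8 _)) ⟩
  8 * (8 * ∑ᵛ 8 K (λ v → collides v s s′)) ≡⟨ cong (8 *_) (collision-count s s′ (s≢s′ ∘ cong (b ∷_))) ⟩
  8 ^ suc K ∎
  where
  open ≡-Reasoning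
  same : ∀ v a → collides (a ∷ v) (b ∷ s) (b ∷ s′) ≡ collides v s s′
  same v a = 𝟙-⇔ (hash (a ∷ v) (b ∷ s) ≟ hash (a ∷ v) (b ∷ s′)) (hash v s ≟ hash v s′)
                 (step-injective a b _ _) (cong (step a b))
... | no b≢b′ = begin
  8 * ∑ᵛ 8 K (λ v → sum λ a → collides (a ∷ v) (b ∷ s) (b′ ∷ s′)) ≡⟨ cong (8 *_) (∑ᵛ-cong 8 K once) ⟩
  8 * ∑ᵛ 8 K (λ v → 1) ≡⟨ cong (8 *_) (trans (∑ᵛ-const 8 K 1) (*-identityʳ (8 ^ K))) ⟩
  8 ^ suc K ∎
  where
  open ≡-Reasoning
  once : ∀ v → sum (λ a → collides (a ∷ v) (b ∷ s) (b′ ∷ s′)) ≡ 1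
  once v = [ ⊥-elim ∘ b≢b′ , id ]′ (step-collides-once b b′ (hash v s) (hash v s′))

∑ᵖ : ∀ K → (Vec (Fin 2) K → Vec (Fin 2) K → ℕ) → ℕ
∑ᵖ K w = ∑ᵛ 2 K λ s → ∑ᵛ 2 K (w s)

∑ᵖ-mono : ∀ K {w w′} → (∀ s s′ → w s s′ ≤ w′ s s′) → ∑ᵖ K w ≤ ∑ᵖ K w′
∑ᵖ-mono K w≤w′ = ∑ᵛ-mono 2 K λ s → ∑ᵛ-mono 2 K (w≤w′ s)

∑ᵖ-distrib-+ : ∀ K w w′ → ∑ᵖ K (λ s s′ → w s s′ + w′ s s′) ≡ ∑ᵖ K w + ∑ᵖ K w′
∑ᵖ-distrib-+ K w w′ =
  trans (∑ᵛ-cong 2 K λ s → ∑ᵛ-distrib-+ 2 K (w s) (w′ s))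
        (∑ᵛ-distrib-+ 2 K (λ s → ∑ᵛ 2 K (w s)) (λ s → ∑ᵛ 2 K (w′ s)))

*-distribˡ-∑ᵖ : ∀ K c w → c * ∑ᵖ K w ≡ ∑ᵖ K (λ s s′ → c * w s s′)
*-distribˡ-∑ᵖ K c w =
  trans (*-distribˡ-∑ᵛ 2 K c _) (∑ᵛ-cong 2 K λ s → *-distribˡ-∑ᵛ 2 K c (w s))

∑ᵛ-∑ᵖ-comm : ∀ m K (w : Vec (Fin m) K → Vec (Fin 2) K → Vec (Fin 2) K → ℕ) →
             ∑ᵛ m K (λ v → ∑ᵖ K (w v)) ≡ ∑ᵖ K (λ s s′ → ∑ᵛ m K (λ v → w v s s′))
∑ᵛ-∑ᵖ-comm m K w =
  trans (∑ᵛ-comm m K 2 K (λ v s → ∑ᵛ 2 K (w v s)))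
        (∑ᵛ-cong 2 K λ s → ∑ᵛ-comm m K 2 K (λ v → w v s))

-- The diagonal is set to 0, since equal strings collide under every hash and would spoil the
-- average.
clash : ∀ {K} → Vec (Fin 8) K → Vec (Fin 2) K → Vec (Fin 2) K → ℕ
clash v s s′ = if does (s ≟ᵛ s′) then 0 else collides v s s′

clash-≢ : ∀ {K} (v : Vec (Fin 8) K) {s s′} → s ≢ s′ → clash v s s′ ≡ collides v s s′
clash-≢ v {s} {s′} s≢s′ with s ≟ᵛ s′
... | yes s≡s′ = contradiction s≡s′ s≢s′
... | no _     = refl

clash≤1 : ∀ {K} (v : Vec (Fin 8) K) s s′ → clash v s s′ ≤ 1
clash≤1 v s s′ with does (s ≟ᵛ s′)
... | true  = z≤n
... | false = 𝟙≤1 (hash v s ≟ hash v s′)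

clash-count : ∀ {K} (s s′ : Vec (Fin 2) K) → 8 * ∑ᵛ 8 K (λ v → clash v s s′) ≤ 8 ^ K
clash-count {K} s s′ with s ≟ᵛ s′
... | yes _   = ≤-trans (≤-reflexive (cong (8 *_) (trans (∑ᵛ-const 8 K 0) (*-zeroʳ (8 ^ K))))) z≤n
... | no s≢s′ = ≤-reflexive (collision-count s s′ s≢s′)

-- After exchanging the sums, each pair contributes on average at most 1/8 of its weight, and some
-- `v` does no worse than the average. The weights let the choice depend on how often a pair has
-- clashed before.
rare-clash : ∀ K w → ∃ λ v → 8 * ∑ᵖ K (λ s s′ → w s s′ * clash v s s′) ≤ ∑ᵖ K w
rare-clash K w = ∑ᵛ-averaging 7 K (λ v → 8 * ∑ᵖ K (weighted v)) (begin
  ∑ᵛ 8 K (λ v → 8 * ∑ᵖ K (weighted v))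
    ≡⟨ sym (*-distribˡ-∑ᵛ 8 K 8 (λ v → ∑ᵖ K (weighted v))) ⟩
  8 * ∑ᵛ 8 K (λ v → ∑ᵖ K (weighted v))
    ≡⟨ cong (8 *_) (∑ᵛ-∑ᵖ-comm 8 K weighted) ⟩
  8 * ∑ᵖ K (λ s s′ → ∑ᵛ 8 K (λ v → weighted v s s′))
    ≡⟨ *-distribˡ-∑ᵖ K 8 (λ s s′ → ∑ᵛ 8 K (λ v → weighted v s s′)) ⟩
  ∑ᵖ K (λ s s′ → 8 * ∑ᵛ 8 K (λ v → weighted v s s′))
    ≤⟨ ∑ᵖ-mono K pointwise ⟩
  ∑ᵖ K (λ s s′ → 8 ^ K * w s s′)
    ≡⟨ sym (*-distribˡ-∑ᵖ K (8 ^ K) w) ⟩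
  8 ^ K * ∑ᵖ K w ∎)
  where
  open ≤-Reasoning
  weighted : Vec (Fin 8) K → Vec (Fin 2) K → Vec (Fin 2) K → ℕ
  weighted v s s′ = w s s′ * clash v s s′
  rearrange : ∀ x y z → x * (y * z) ≡ x * z * y
  rearrange = solve-∀
  pointwise : ∀ s s′ → 8 * ∑ᵛ 8 K (λ v → weighted v s s′) ≤ 8 ^ K * w s s′
  pointwise s s′ = begin
    8 * ∑ᵛ 8 K (λ v → weighted v s s′)             ≡⟨ cong (8 *_) (sym (*-distribˡ-∑ᵛ 8 K (w s s′) (λ v → clash v s s′))) ⟩
    8 * (w s s′ * ∑ᵛ 8 K (λ v → clash v s s′))     ≡⟨ rearrange 8 (w s s′) _ ⟩
    8 * ∑ᵛ 8 K (λ v → clash v s s′) * w s s′       ≤⟨ *-monoˡ-≤ (w s s′) (clash-count s s′) ⟩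
    8 ^ K * w s s′                                 ∎

agreement : ∀ {K N} → (Fin N → Vec (Fin 8) K) → Vec (Fin 2) K → Vec (Fin 2) K → ℕ
agreement a s s′ = sum λ j → clash (a j) s s′

-- Greedy choice of hash functions: 8 ^ agreement is a potential whose total at most
-- doubles with each function.
low-potential : ∀ K N → ∃ λ (a : Fin N → Vec (Fin 8) K) → ∑ᵖ K (λ s s′ → 8 ^ agreement a s s′) ≤ 2 ^ N * 4 ^ K
low-potential K zero = (λ ()) , ≤-reflexive (begin
  ∑ᵖ K (λ _ _ → 1)      ≡⟨ ∑ᵛ-cong 2 K (λ _ → trans (∑ᵛ-const 2 K 1) (*-identityʳ (2 ^ K))) ⟩
  ∑ᵛ 2 K (λ _ → 2 ^ K)  ≡⟨ ∑ᵛ-const 2 K (2 ^ K) ⟩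
  2 ^ K * 2 ^ K         ≡⟨ sym (^-distribʳ-* K 2 2) ⟩
  4 ^ K                 ≡⟨ sym (*-identityˡ (4 ^ K)) ⟩
  1 * 4 ^ K             ∎)
  where open ≡-Reasoning
low-potential K (suc N) = a′ , (begin
  ∑ᵖ K (λ s s′ → 8 ^ (clash v s s′ + agreement a s s′))   ≤⟨ ∑ᵖ-mono K (λ s s′ → grow (agreement a s s′) (clash≤1 v s s′)) ⟩
  ∑ᵖ K (λ s s′ → 8 * (w s s′ * clash v s s′) + w s s′)    ≡⟨ ∑ᵖ-distrib-+ K (λ s s′ → 8 * (w s s′ * clash v s s′)) w ⟩
  ∑ᵖ K (λ s s′ → 8 * (w s s′ * clash v s s′)) + ∑ᵖ K w
    ≡⟨ cong (_+ ∑ᵖ K w) (sym (*-distribˡ-∑ᵖ K 8 (λ s s′ → w s s′ * clash v s s′))) ⟩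
  8 * ∑ᵖ K (λ s s′ → w s s′ * clash v s s′) + ∑ᵖ K w      ≤⟨ +-mono-≤ v-rare small ⟩
  ∑ᵖ K w + 2 ^ N * 4 ^ K                                  ≤⟨ +-monoˡ-≤ _ small ⟩
  2 ^ N * 4 ^ K + 2 ^ N * 4 ^ K                           ≡⟨ double (2 ^ N) (4 ^ K) ⟩
  2 ^ suc N * 4 ^ K                                       ∎)
  where
  open ≤-Reasoning
  a = proj₁ (low-potential K N)
  small = proj₂ (low-potential K N)
  w : Vec (Fin 2) K → Vec (Fin 2) K → ℕ
  w s s′ = 8 ^ agreement a s s′
  v = proj₁ (rare-clash K w)
  v-rare = proj₂ (rare-clash K w)
  a′ : Fin (suc N) → Vec (Fin 8) K
  a′ zero    = v
  a′ (suc j) = a j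
  double : ∀ x y → x * y + x * y ≡ 2 * x * y
  double = solve-∀
  -- For c in {0, 1} this is the bound 8 ^ c ≤ 1 + 8 * c. It is linear in c, so `rare-clash`
  -- applies; the two summands give the factor 2 per hash.
  grow : ∀ y {c} → c ≤ 1 → 8 ^ (c + y) ≤ 8 * (8 ^ y * c) + 8 ^ y
  grow y z≤n       = m≤n+m _ _
  grow y (s≤s z≤n) = ≤-trans (≤-reflexive (cong (8 *_) (sym (*-identityʳ (8 ^ y))))) (m≤m+n _ _)

module _ (K : ℕ) where
  numHashes : ℕ
  numHashes = 4 * K + 1

  private
    N = numHashes

  -- A pair with agreement A and N ≤ 2 * A would, through its single term of the potential, give 8 ^
  -- N ≤ (2 ^ N * 4 ^ K) ^ 2, hence 2 ^ N ≤ 2 ^ (4 * K). The choice N = 4 * K + 1 is the first to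
  -- exclude this.
  hash-family : ∃ λ (a : Fin N → Vec (Fin 8) K) → ∀ {s s′} → s ≢ s′ → 2 * sum (λ j → collides (a j) s s′) < N
  hash-family = a , λ {s} {s′} s≢s′ →
    subst (λ x → 2 * x < N) (sum-cong-≗ λ j → clash-≢ (a j) s≢s′) (≰⇒> (few s s′))
    where
    open ≤-Reasoning
    a = proj₁ (low-potential K N)
    few : ∀ s s′ → ¬ (N ≤ 2 * agreement a s s′)
    few s s′ N≤2A = contradiction (*-cancelˡ-≤ (4 ^ N) {{m^n≢0 4 N}} (begin
      4 ^ N * 2 ^ N                       ≡⟨ sym (^-distribʳ-* N 4 2) ⟩
      8 ^ N                               ≤⟨ ^-monoʳ-≤ 8 N≤2A ⟩
      8 ^ (2 * A)                         ≡⟨ cong (λ x → 8 ^ (A + x)) (+-identityʳ A) ⟩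
      8 ^ (A + A)                         ≡⟨ ^-distribˡ-+-* 8 A A ⟩
      8 ^ A * 8 ^ A                       ≤⟨ *-mono-≤ 8^A≤ 8^A≤ ⟩
      2 ^ N * 4 ^ K * (2 ^ N * 4 ^ K)     ≡⟨ rearrange (2 ^ N) (4 ^ K) ⟩
      2 ^ N * 2 ^ N * (4 ^ K * 4 ^ K)     ≡⟨ sym (cong₂ _*_ (^-distribʳ-* N 2 2) (^-distribʳ-* K 4 4)) ⟩
      4 ^ N * 16 ^ K                      ≡⟨ cong (4 ^ N *_) (^-*-assoc 2 4 K) ⟩
      4 ^ N * 2 ^ (4 * K)                 ∎))
      (<⇒≱ (^-monoʳ-< 2 (s≤s (s≤s z≤n)) (≤-reflexive (+-comm 1 (4 * K)))))
      where
      A = agreement a s s′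
      8^A≤ : 8 ^ A ≤ 2 ^ N * 4 ^ K
      8^A≤ = ≤-trans (term≤∑ᵛ 2 K (λ s′ → 8 ^ agreement a s s′) s′)
               (≤-trans (term≤∑ᵛ 2 K (λ s → ∑ᵛ 2 K (λ s′ → 8 ^ agreement a s s′)) s) (proj₂ (low-potential K N)))
      rearrange : ∀ x y → x * y * (x * y) ≡ x * x * (y * y)
      rearrange = solve-∀

-- Tropical circuits as formal polynomials

-- Valuations with natural values already determine enough about the monomials, so the analysis of
-- circuits moves to ℕ along this order embedding.
ι : ℕ → ℚ.ℚ
ι zero    = ℚ.0ℚ
ι (suc n) = ℚ.1ℚ ℚ.+ ι n

ι-+ : ∀ m n → ι (m + n) ≡ ι m ℚ.+ ι n
ι-+ zero    n = sym (ℚ.+-identityˡ (ι n))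
ι-+ (suc m) n = trans (cong (ℚ.1ℚ ℚ.+_) (ι-+ m n)) (sym (ℚ.+-assoc ℚ.1ℚ (ι m) (ι n)))

0≤ι : ∀ n → ℚ.0ℚ ℚ.≤ ι n
0≤ι zero    = ℚ.≤-refl
0≤ι (suc n) = ℚ.+-mono-≤ {ℚ.0ℚ} {ℚ.1ℚ} {ℚ.0ℚ} (ℚ.nonNegative⁻¹ ℚ.1ℚ) (0≤ι n)

ι-mono : ∀ {m n} → m ≤ n → ι m ℚ.≤ ι n
ι-mono {n = n} z≤n = 0≤ι n
ι-mono (s≤s m≤n) = ℚ.+-monoʳ-≤ ℚ.1ℚ (ι-mono m≤n)

ι-strict : ∀ {m n} → m < n → ι m ℚ.< ι n
ι-strict {n = suc n} (s≤s z≤n) =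
  ℚ.+-mono-<-≤ {ℚ.0ℚ} {ℚ.1ℚ} {ℚ.0ℚ} (ℚ.positive⁻¹ ℚ.1ℚ) (0≤ι n)
ι-strict (s≤s m<n@(s≤s _)) = ℚ.+-monoʳ-< ℚ.1ℚ (ι-strict m<n)

ι-cancel-≤ : ∀ m n → ι m ℚ.≤ ι n → m ≤ n
ι-cancel-≤ m n ιm≤ιn with m ≤? n
... | yes m≤n = m≤n
... | no  m≰n = contradiction (ℚ.<-≤-trans (ι-strict (≰⇒> m≰n)) ιm≤ιn) (ℚ.<-irrefl refl)

ι-⊔ : ∀ m n → ι (m ⊔ n) ≡ ι m ℚ.⊔ ι n
ι-⊔ m n with ≤-total m n
... | inj₁ m≤n = trans (cong ι (m≤n⇒m⊔n≡n m≤n)) (sym (ℚ.p≤q⇒p⊔q≡q (ι-mono m≤n)))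
... | inj₂ n≤m = trans (cong ι (m≥n⇒m⊔n≡m n≤m)) (sym (ℚ.p≥q⇒p⊔q≡p (ι-mono n≤m)))

evalℕ : ∀ {n s} → Circuit n s → (Fin n → ℕ) → Fin s → ℕ
evalℕ (C ▷ var v)    ν zero    = ν v
evalℕ (C ▷ const0)   ν zero    = 0
evalℕ (C ▷ plus a b) ν zero    = evalℕ C ν a + evalℕ C ν b
evalℕ (C ▷ maxg a b) ν zero    = evalℕ C ν a ⊔ evalℕ C ν b
evalℕ (C ▷ _)        ν (suc i) = evalℕ C ν i

evalAll-ι : ∀ {n s} (C : Circuit n s) ν i → evalAll C (ι ∘ ν) i ≡ ι (evalℕ C ν i)
evalAll-ι (C ▷ var v)    ν zero = refl
evalAll-ι (C ▷ const0)   ν zero = refl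
evalAll-ι (C ▷ plus a b) ν zero =
  trans (cong₂ ℚ._+_ (evalAll-ι C ν a) (evalAll-ι C ν b)) (sym (ι-+ (evalℕ C ν a) _))
evalAll-ι (C ▷ maxg a b) ν zero =
  trans (cong₂ ℚ._⊔_ (evalAll-ι C ν a) (evalAll-ι C ν b)) (sym (ι-⊔ (evalℕ C ν a) _))
evalAll-ι (C ▷ var _)    ν (suc i) = evalAll-ι C ν i
evalAll-ι (C ▷ const0)   ν (suc i) = evalAll-ι C ν i
evalAll-ι (C ▷ plus _ _) ν (suc i) = evalAll-ι C ν i
evalAll-ι (C ▷ maxg _ _) ν (suc i) = evalAll-ι C ν i

Exponents : ℕ → Set
Exponents n = Fin n → ℕ

infixl 6 _⊕_
_⊕_ : ∀ {n} → Exponents n → Exponents n → Exponents n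
(e ⊕ f) v = e v + f v

δ : ∀ {n} → Fin n → Exponents n
δ v u = 𝟙 (v ≟ u)

dot : ∀ {n} → Exponents n → (Fin n → ℕ) → ℕ
dot e ν = sum λ v → e v * ν v

dot-cong : ∀ {n} {e f : Exponents n} (ν : Fin n → ℕ) → e ≗ f → dot e ν ≡ dot f ν
dot-cong ν e≗f = sum-cong-≗ λ v → cong (_* ν v) (e≗f v)

dot-⊕ˡ : ∀ {n} (e f ν : Exponents n) → dot (e ⊕ f) ν ≡ dot e ν + dot f ν
dot-⊕ˡ e f ν = trans (sum-cong-≗ λ v → *-distribʳ-+ (ν v) (e v) (f v))
                     (∑-distrib-+ (λ v → e v * ν v) (λ v → f v * ν v))

dot-comm : ∀ {n} (e f : Exponents n) → dot e f ≡ dot f e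
dot-comm e f = sum-cong-≗ λ v → *-comm (e v) (f v)

dot-⊕ʳ : ∀ {n} (e ν μ : Exponents n) → dot e (ν ⊕ μ) ≡ dot e ν + dot e μ
dot-⊕ʳ e ν μ = trans (dot-comm e (ν ⊕ μ))
  (trans (dot-⊕ˡ ν μ e) (cong₂ _+_ (dot-comm ν e) (dot-comm μ e)))

dot-0 : ∀ {n} (ν : Fin n → ℕ) → dot (λ _ → 0) ν ≡ 0
dot-0 {n} ν = trans (∑-const n 0) (*-zeroʳ n)

dot-δˡ : ∀ {n} (v : Fin n) ν → dot (δ v) ν ≡ ν v
dot-δˡ zero    ν = trans (cong (1 * ν zero +_) (dot-0 (ν ∘ suc))) (trans (+-identityʳ _) (*-identityˡ _))
dot-δˡ (suc v) ν = dot-δˡ v (ν ∘ suc)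

dot-δʳ : ∀ {n} e (v : Fin n) → dot e (δ v) ≡ e v
dot-δʳ e v = trans (dot-comm e (δ v)) (dot-δˡ v e)

-- The monomials given by parse trees, before any domination under max. Exponents may exceed 1 here,
-- and they are compared only pointwise, so predicates on them have to respect `≗`.
Produces : ∀ {n s} → Circuit n s → Fin s → Exponents n → Set
Produces (C ▷ var v)    zero    e = e ≗ δ v
Produces (C ▷ const0)   zero    e = e ≗ λ _ → 0
Produces (C ▷ plus a b) zero    e = ∃₂ λ e₁ e₂ → Produces C a e₁ × Produces C b e₂ × e ≗ e₁ ⊕ e₂
Produces (C ▷ maxg a b) zero    e = Produces C a e ⊎ Produces C b e
Produces (C ▷ _)        (suc i) e = Produces C i e

Produces-resp-≗ : ∀ {n s} (C : Circuit n s) i {e e′} → e ≗ e′ → Produces C i e → Produces C i e′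
Produces-resp-≗ (C ▷ var v)    zero e≗e′ p = λ u → trans (sym (e≗e′ u)) (p u)
Produces-resp-≗ (C ▷ const0)   zero e≗e′ p = λ u → trans (sym (e≗e′ u)) (p u)
Produces-resp-≗ (C ▷ plus a b) zero e≗e′ (e₁ , e₂ , p₁ , p₂ , p) =
  e₁ , e₂ , p₁ , p₂ , λ u → trans (sym (e≗e′ u)) (p u)
Produces-resp-≗ (C ▷ maxg a b) zero e≗e′ (inj₁ p) = inj₁ (Produces-resp-≗ C a e≗e′ p)
Produces-resp-≗ (C ▷ maxg a b) zero e≗e′ (inj₂ p) = inj₂ (Produces-resp-≗ C b e≗e′ p)
Produces-resp-≗ (C ▷ var _)    (suc i) = Produces-resp-≗ C i
Produces-resp-≗ (C ▷ const0)   (suc i) = Produces-resp-≗ C i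
Produces-resp-≗ (C ▷ plus _ _) (suc i) = Produces-resp-≗ C i
Produces-resp-≗ (C ▷ maxg _ _) (suc i) = Produces-resp-≗ C i

produced≤eval : ∀ {n s} (C : Circuit n s) i ν {e} → Produces C i e → dot e ν ≤ evalℕ C ν i
produced≤eval (C ▷ var v)    zero ν p = ≤-reflexive (trans (dot-cong ν p) (dot-δˡ v ν))
produced≤eval (C ▷ const0)   zero ν p = ≤-reflexive (trans (dot-cong ν p) (dot-0 ν))
produced≤eval (C ▷ plus a b) zero ν (e₁ , e₂ , p₁ , p₂ , p) =
  ≤-trans (≤-reflexive (trans (dot-cong ν p) (dot-⊕ˡ e₁ e₂ ν)))
          (+-mono-≤ (produced≤eval C a ν p₁) (produced≤eval C b ν p₂))
produced≤eval (C ▷ maxg a b) zero ν (inj₁ p) = ≤-trans (produced≤eval C a ν p) (m≤m⊔n _ _)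
produced≤eval (C ▷ maxg a b) zero ν (inj₂ p) = ≤-trans (produced≤eval C b ν p) (m≤n⊔m _ _)
produced≤eval (C ▷ var _)    (suc i) = produced≤eval C i
produced≤eval (C ▷ const0)   (suc i) = produced≤eval C i
produced≤eval (C ▷ plus _ _) (suc i) = produced≤eval C i
produced≤eval (C ▷ maxg _ _) (suc i) = produced≤eval C i

-- Following the larger input at every max gate yields an optimal parse tree. With `produced≤eval`,
-- a node's value is the maximum over its monomials.
eval-attained : ∀ {n s} (C : Circuit n s) i ν → ∃ λ e → Produces C i e × dot e ν ≡ evalℕ C ν i
eval-attained (C ▷ var v)    zero ν = δ v , (λ _ → refl) , dot-δˡ v ν
eval-attained (C ▷ const0)   zero ν = (λ _ → 0) , (λ _ → refl) , dot-0 ν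
eval-attained (C ▷ plus a b) zero ν =
  let e₁ , p₁ , eq₁ = eval-attained C a ν
      e₂ , p₂ , eq₂ = eval-attained C b ν
  in e₁ ⊕ e₂ , (e₁ , e₂ , p₁ , p₂ , λ _ → refl) , trans (dot-⊕ˡ e₁ e₂ ν) (cong₂ _+_ eq₁ eq₂)
eval-attained (C ▷ maxg a b) zero ν with ≤-total (evalℕ C ν a) (evalℕ C ν b)
... | inj₁ a≤b = let e , p , eq = eval-attained C b ν in e , inj₂ p , trans eq (sym (m≤n⇒m⊔n≡n a≤b))
... | inj₂ b≤a = let e , p , eq = eval-attained C a ν in e , inj₁ p , trans eq (sym (m≥n⇒m⊔n≡m b≤a))
eval-attained (C ▷ var _)    (suc i) = eval-attained C i
eval-attained (C ▷ const0)   (suc i) = eval-attained C i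
eval-attained (C ▷ plus _ _) (suc i) = eval-attained C i
eval-attained (C ▷ maxg _ _) (suc i) = eval-attained C i

char : ∀ {n} → Subset n → Exponents n
char I v = if lookup I v then 1 else 0

char≤1 : ∀ {n} (I : Subset n) v → char I v ≤ 1
char≤1 I v with lookup I v
... | true  = s≤s z≤n
... | false = z≤n

char-∈ : ∀ {n} {I : Subset n} {v} → v ∈ I → char I v ≡ 1
char-∈ v∈I rewrite []=⇒lookup v∈I = refl

0<char : ∀ {n} (I : Subset n) v → 0 < char I v → v ∈ I
0<char I v 0<c with lookup I v in eq
... | true = lookup⇒[]= v I eq

weight-ι : ∀ {n} (ν : Fin n → ℕ) I → weight (ι ∘ ν) I ≡ ι (dot (char I) ν)
weight-ι ν []          = refl
weight-ι ν (true  ∷ I) =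
  trans (cong₂ ℚ._+_ (cong ι (sym (*-identityˡ (ν zero)))) (weight-ι (ν ∘ suc) I)) (sym (ι-+ (1 * ν zero) _))
weight-ι ν (false ∷ I) = trans (ℚ.+-identityˡ _) (weight-ι (ν ∘ suc) I)

-- Factorisations at a plus gate and the existence of a balanced one

data Part : Set where
  left right rest : Part

-- A monomial of gate g split at g: the parts contributed by the two inputs of g,
-- and the cofactor that completes any monomial of g to one satisfying Q.
Split : ∀ {n s} → Circuit n s → Fin s → Exponents n → Exponents n → Set
Split (C ▷ plus a b) zero    e₁ e₂ = Produces C a e₁ × Produces C b e₂
Split (C ▷ _)        zero    e₁ e₂ = ⊥
Split (C ▷ _)        (suc i) e₁ e₂ = Split C i e₁ e₂

Split⇒Produces : ∀ {n s} (C : Circuit n s) i {e₁ e₂} → Split C i e₁ e₂ → Produces C i (e₁ ⊕ e₂)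
Split⇒Produces (C ▷ plus a b) zero (p₁ , p₂) = _ , _ , p₁ , p₂ , λ _ → refl
Split⇒Produces (C ▷ var _)    (suc i) = Split⇒Produces C i
Split⇒Produces (C ▷ const0)   (suc i) = Split⇒Produces C i
Split⇒Produces (C ▷ plus _ _) (suc i) = Split⇒Produces C i
Split⇒Produces (C ▷ maxg _ _) (suc i) = Split⇒Produces C i

Split-swap : ∀ {n s} (C : Circuit n s) i {e₁ e₂ e₁′ e₂′} →
             Split C i e₁ e₂ → Split C i e₁′ e₂′ → Split C i e₁ e₂′
Split-swap (C ▷ plus a b) zero (p₁ , _) (_ , p₂′) = p₁ , p₂′
Split-swap (C ▷ var _)    (suc i) = Split-swap C i
Split-swap (C ▷ const0)   (suc i) = Split-swap C i
Split-swap (C ▷ plus _ _) (suc i) = Split-swap C i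
Split-swap (C ▷ maxg _ _) (suc i) = Split-swap C i

Cofactor : ∀ {n s} → Circuit n s → (Exponents n → Set) → Fin s → Exponents n → Set
Cofactor C Q i f = ∀ e → Produces C i e → Q (e ⊕ f)

total : ∀ {n} → (Part → Exponents n) → Exponents n
total E = E left ⊕ E right ⊕ E rest

Factors : ∀ {n s} → Circuit n s → (Exponents n → Set) → Fin s → (Part → Exponents n) → Set
Factors C Q i E = Split C i (E left) (E right) × Cofactor C Q i (E rest)

Factors⇒Q : ∀ {n s} (C : Circuit n s) Q E {i} → Factors C Q i E → Q (total {n} E)
Factors⇒Q C Q E (split , cofactor) = cofactor _ (Split⇒Produces C _ split)

mixture : ∀ {n} → (Part → Bool) → (E E′ : Part → Exponents n) → Part → Exponents n
mixture c E E′ p = if c p then E p else E′ p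

-- The left input, the right input and the context of a gate can be chosen independently of each
-- other, so each may come from either factorisation.
Factors-mixture : ∀ {n s} (C : Circuit n s) Q E E′ c {i} →
                  Factors C Q i E → Factors C Q i E′ → Factors C Q i (mixture {n} c E E′)
Factors-mixture C Q E E′ c {i} (s , f) (s′ , f′) = split , cofactor
  where
  split : Split C i (mixture c E E′ left) (mixture c E E′ right)
  split with c left | c right
  ... | true  | true  = s
  ... | true  | false = Split-swap C i s s′
  ... | false | true  = Split-swap C i s′ s
  ... | false | false = s′
  cofactor : Cofactor C Q i (mixture c E E′ rest)
  cofactor with c rest
  ... | true  = f
  ... | false = f′

part≤total : ∀ {n} (E : Part → Exponents n) p v → E p v ≤ total E v
part≤total E left  v = ≤-trans (m≤m+n _ (E right v)) (m≤m+n _ _)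
part≤total E right v = ≤-trans (m≤n+m _ (E left v)) (m≤m+n _ _)
part≤total E rest  v = m≤n+m _ _

0<total⇒part : ∀ {n} (E : Part → Exponents n) v → 0 < total E v → ∃ λ p → 0 < E p v
0<total⇒part E v 0<t with E left v in l | E right v in r
... | suc _ | _     = left  , subst (0 <_) (sym l) (s≤s z≤n)
... | zero  | suc _ = right , subst (0 <_) (sym r) (s≤s z≤n)
... | zero  | zero  = rest  , 0<t

-- The degree of a monomial in the marked vertices `m j`, which will be the final vertices of the
-- chains.
share : ∀ {n N} → (Fin N → Fin n) → Exponents n → ℕ
share m e = sum (e ∘ m)

share-⊕ : ∀ {n N} (m : Fin N → Fin n) e f → share m (e ⊕ f) ≡ share m e + share m f
share-⊕ m e f = ∑-distrib-+ (e ∘ m) (f ∘ m)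

module _ {n N} (m : Fin N → Fin n) (m-inj : ∀ i j → m i ≡ m j → i ≡ j) (2≤N : 2 ≤ N)
         (Q : Exponents n → Set) (Q-resp-≗ : ∀ {e e′} → e ≗ e′ → Q e → Q e′) where

  share-δ : ∀ v → share m (δ v) ≤ 1
  share-δ v = ∑-atMostOne (λ i → v ≟ m i) λ i j p q → m-inj i j (trans (sym p) q)

  Balanced : (Part → Exponents n) → Set
  Balanced E = 2 * share m (E left) ≤ N × 2 * share m (E right) ≤ N
             × N < 2 * (share m (E left) + share m (E right))

  -- Descend to an input that still carries more than half of the marked vertices, moving the other
  -- input into the cofactor. The descent stops at a plus gate with two light inputs; it cannot
  -- reach a leaf, which carries at most one marked vertex while 2 ≤ N.
  heavy-gate : ∀ {s} (C : Circuit n s) i e f → Produces C i e → Cofactor C Q i f → N < 2 * share m e →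
               ∃₂ λ g E → Factors C Q g E × total E ≗ e ⊕ f × Balanced E
  heavy-gate (C ▷ var v) zero e f p cof N<e =
    contradiction (≤-trans (*-monoʳ-≤ 2 (≤-trans (≤-reflexive (sum-cong-≗ (p ∘ m))) (share-δ v))) 2≤N)
                  (<⇒≱ N<e)
  heavy-gate (C ▷ const0) zero e f p cof N<e =
    contradiction (≤-trans (≤-reflexive (cong (2 *_) (trans (sum-cong-≗ (p ∘ m)) (trans (∑-const N 0) (*-zeroʳ N))))) z≤n)
                  (<⇒≱ N<e)
  heavy-gate (C ▷ plus a b) zero e f (e₁ , e₂ , p₁ , p₂ , p) cof N<e
    with 2 * share m e₁ ≤? N | 2 * share m e₂ ≤? N
  ... | yes light₁ | yes light₂ =
    zero , E , ((p₁ , p₂) , cof) , (λ u → cong (_+ f u) (sym (p u))) ,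
    light₁ , light₂ , subst (λ x → N < 2 * x) (trans (sum-cong-≗ (p ∘ m)) (share-⊕ m e₁ e₂)) N<e
    where
    E : Part → Exponents n
    E left  = e₁
    E right = e₂
    E rest  = f
  ... | no heavy₁ | _ =
    let g , E , F , eq , bal = heavy-gate C a e₁ (e₂ ⊕ f) p₁ cof₁ (≰⇒> heavy₁)
    in suc g , E , F ,
       (λ u → trans (eq u) (trans (sym (+-assoc (e₁ u) (e₂ u) (f u))) (cong (_+ f u) (sym (p u))))) , bal
    where
    cof₁ : Cofactor C Q a (e₂ ⊕ f)
    cof₁ e′ p′ = Q-resp-≗ (λ u → +-assoc (e′ u) (e₂ u) (f u)) (cof (e′ ⊕ e₂) (e′ , e₂ , p′ , p₂ , λ _ → refl))
  ... | yes _ | no heavy₂ =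
    let g , E , F , eq , bal = heavy-gate C b e₂ (e₁ ⊕ f) p₂ cof₂ (≰⇒> heavy₂)
    in suc g , E , F ,
       (λ u → trans (eq u) (trans (rearrange (e₁ u) (e₂ u) (f u)) (cong (_+ f u) (sym (p u))))) , bal
    where
    rearrange : ∀ x y z → y + (x + z) ≡ x + y + z
    rearrange = solve-∀
    cof₂ : Cofactor C Q b (e₁ ⊕ f)
    cof₂ e′ p′ = Q-resp-≗ (λ u → sym (rearrange (e₁ u) (e′ u) (f u))) (cof (e₁ ⊕ e′) (e₁ , e′ , p₁ , p′ , λ _ → refl))
  heavy-gate (C ▷ maxg a b) zero e f (inj₁ p) cof N<e =
    let g , E , r = heavy-gate C a e f p (λ e′ → cof e′ ∘ inj₁) N<e in suc g , E , r
  heavy-gate (C ▷ maxg a b) zero e f (inj₂ p) cof N<e =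
    let g , E , r = heavy-gate C b e f p (λ e′ → cof e′ ∘ inj₂) N<e in suc g , E , r
  heavy-gate (C ▷ var _) (suc i) e f p cof N<e =
    let g , E , r = heavy-gate C i e f p cof N<e in suc g , E , r
  heavy-gate (C ▷ const0) (suc i) e f p cof N<e =
    let g , E , r = heavy-gate C i e f p cof N<e in suc g , E , r
  heavy-gate (C ▷ plus _ _) (suc i) e f p cof N<e =
    let g , E , r = heavy-gate C i e f p cof N<e in suc g , E , r
  heavy-gate (C ▷ maxg _ _) (suc i) e f p cof N<e =
    let g , E , r = heavy-gate C i e f p cof N<e in suc g , E , r

-- Monomials of a circuit that calculates the independent set polynomial

module Calculating {n s} {G : Graph n} (C : Circuit n s) (out : Fin s) (calc : Calculates G C out) where

  weight≤eval : ∀ ν I → Independent G I → dot (char I) ν ≤ evalℕ C ν out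
  weight≤eval ν I ind = ι-cancel-≤ _ _
    (subst₂ ℚ._≤_ (weight-ι ν I) (evalAll-ι C ν out) (proj₁ (calc (ι ∘ ν)) I ind))

  weight-attained : ∀ ν → ∃ λ I → Independent G I × evalℕ C ν out ≤ dot (char I) ν
  weight-attained ν = let I , ind , eq = proj₂ (calc (ι ∘ ν)) in
    I , ind , ι-cancel-≤ _ _ (ℚ.≤-reflexive (trans (sym (evalAll-ι C ν out)) (trans (sym eq) (weight-ι ν I))))

  produced≤weight : ∀ ν {e} → Produces C out e → ∃ λ I → Independent G I × dot e ν ≤ dot (char I) ν
  produced≤weight ν p = let I , ind , le = weight-attained ν in I , ind , ≤-trans (produced≤eval C out ν p) le

  -- Under the valuation `δ v` no independent set weighs more than 1.
  produced-multilinear : ∀ {e} → Produces C out e → ∀ v → e v ≤ 1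
  produced-multilinear {e} p v = let I , _ , le = produced≤weight (δ v) p in
    ≤-trans (subst₂ _≤_ (dot-δʳ e v) (dot-δʳ (char I) v) le) (char≤1 I v)

  -- Under `δ u ⊕ δ v` such a monomial would reach 2, and then some independent set would contain
  -- both ends of the edge.
  produced-independent : ∀ {e} → Produces C out e → ∀ {u v} → Adj G u v → 0 < e u → 0 < e v → ⊥
  produced-independent {e} p {u} {v} adj 0<u 0<v =
    let I , ind , le = produced≤weight (δ u ⊕ δ v) p
        2≤ = ≤-trans (+-mono-≤ 0<u 0<v) (subst₂ _≤_ (dot-pair e) (dot-pair (char I)) le)
        u∈ = 0<char I u (+-cancelʳ-≤ 1 _ _ (≤-trans 2≤ (+-monoʳ-≤ (char I u) (char≤1 I v))))
        v∈ = 0<char I v (+-cancelˡ-≤ 1 _ _ (≤-trans 2≤ (+-monoˡ-≤ (char I v) (char≤1 I u))))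
    in ind u v u∈ v∈ adj
    where
    dot-pair : ∀ f → dot f (δ u ⊕ δ v) ≡ f u + f v
    dot-pair f = trans (dot-⊕ʳ f (δ u) (δ v)) (cong₂ _+_ (dot-δʳ f u) (dot-δʳ f v))

  -- Under the valuation `char I` an optimal monomial weighs at least as much as I. Its exponents
  -- are at most 1, so it cannot miss any vertex of I.
  independent-produced : ∀ I → Independent G I → ∃ λ e → Produces C out e × (∀ {v} → v ∈ I → 0 < e v)
  independent-produced I ind = e , p , λ {v} v∈I →
    subst₂ _≤_ (cong (λ x → x * x) (char-∈ v∈I)) (trans (cong (e v *_) (char-∈ v∈I)) (*-identityʳ (e v)))
      (∑-tight (λ w → pointwise w) (≤-trans (weight≤eval χ I ind) (≤-reflexive (sym eq))) v)
    where
    χ = char I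
    attained = eval-attained C out χ
    e = proj₁ attained
    p = proj₁ (proj₂ attained)
    eq = proj₂ (proj₂ attained)
    pointwise : ∀ w → e w * χ w ≤ χ w * χ w
    pointwise w with lookup I w
    ... | true  = *-monoˡ-≤ 1 (produced-multilinear p w)
    ... | false = ≤-reflexive (*-zeroʳ (e w))

  record Certificate {N} (m : Fin N → Fin n) (I : Subset n) (g : Fin s) : Set where
    field
      part    : Part → Exponents n
      factors : Factors C (Produces C out) g part
      covers  : ∀ {v} → v ∈ I → ∃ λ p → 0 < part p v
      light   : ∀ p → 2 * share m (part p) ≤ N

  certificate : ∀ {N} (m : Fin N → Fin n) → (∀ i j → m i ≡ m j → i ≡ j) → 2 ≤ N →
                ∀ I → Independent G I → (∀ j → m j ∈ I) → ∃ (Certificate m I)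
  certificate {N} m m-inj 2≤N I ind m∈I = g , record
    { part    = E
    ; factors = F
    ; covers  = λ {v} v∈I → 0<total⇒part E v (subst (0 <_) (sym (eq v)) (≤-trans (e≥ v∈I) (m≤m+n _ 0)))
    ; light   = light
    }
    where
    produced = independent-produced I ind
    e = proj₁ produced
    pe = proj₁ (proj₂ produced)
    e≥ : ∀ {v} → v ∈ I → 0 < e v
    e≥ = proj₂ (proj₂ produced)
    N≤share : N ≤ share m e
    N≤share = subst (_≤ share m e) (trans (∑-const N 1) (*-identityʳ N)) (∑-mono λ j → e≥ (m∈I j))
    N<2share : N < 2 * share m e
    N<2share = ≤-trans (s≤s N≤share) (≤-trans (+-monoˡ-≤ _ (≤-trans (≤-trans (s≤s z≤n) 2≤N) N≤share))
                 (≤-reflexive (cong (share m e +_) (sym (+-identityʳ _)))))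
    found = heavy-gate m m-inj 2≤N (Produces C out) (Produces-resp-≗ C out) C out e (λ _ → 0) pe
              (λ e′ → Produces-resp-≗ C out (λ u → sym (+-identityʳ (e′ u)))) N<2share
    g = proj₁ found
    E = proj₁ (proj₂ found)
    F = proj₁ (proj₂ (proj₂ found))
    eq = proj₁ (proj₂ (proj₂ (proj₂ found)))
    balanced = proj₂ (proj₂ (proj₂ (proj₂ found)))
    share-total : share m (E left) + share m (E right) + share m (E rest) ≤ N
    share-total = subst₂ _≤_
      (trans (share-⊕ m (E left ⊕ E right) (E rest)) (cong (_+ share m (E rest)) (share-⊕ m (E left) (E right))))
      (trans (∑-const N 1) (*-identityʳ N))
      (∑-mono λ j → produced-multilinear {total E} (Factors⇒Q C (Produces C out) E F) (m j))
    light : ∀ p → 2 * share m (E p) ≤ N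
    light left  = proj₁ balanced
    light right = proj₁ (proj₂ balanced)
    -- Left and right together exceed N / 2 and, by multilinearity, all three parts together hold at
    -- most N.
    light rest  = <⇒≤ (+-cancelˡ-< N _ _ (≤-trans (+-monoˡ-< (2 * share m (E rest)) (proj₂ (proj₂ balanced)))
      (≤-trans (≤-reflexive (sym (*-distribˡ-+ 2 (share m (E left) + share m (E right)) _)))
        (≤-trans (*-monoʳ-≤ 2 share-total) (≤-reflexive (cong (N +_) (+-identityʳ N)))))))

  -- Mixing two factorisations at the same gate again gives independent sets.
  adjacent⇒same-part : ∀ {g E E′} → Factors C (Produces C out) g E → Factors C (Produces C out) g E′ →
                       ∀ {u v} → Adj G u v → ∀ p p′ → 0 < E p u → 0 < E′ p′ v → p ≡ p′
  adjacent⇒same-part {g} {E} {E′} F F′ {u} {v} adj = λ where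
      left  left  _ _ → refl
      right right _ _ → refl
      rest  rest  _ _ → refl
      p@left  p′@right → disjoint p p′ (λ { left → true ; _ → false }) refl refl
      p@left  p′@rest  → disjoint p p′ (λ { left → true ; _ → false }) refl refl
      p@right p′@left  → disjoint p p′ (λ { right → true ; _ → false }) refl refl
      p@right p′@rest  → disjoint p p′ (λ { right → true ; _ → false }) refl refl
      p@rest  p′@left  → disjoint p p′ (λ { rest → true ; _ → false }) refl refl
      p@rest  p′@right → disjoint p p′ (λ { rest → true ; _ → false }) refl refl
    where
    -- The selector takes `p` from E and `p′` from E′, so the mixture would be a produced monomial
    -- containing both ends of an edge.
    disjoint : ∀ p p′ (c : Part → Bool) → c p ≡ true → c p′ ≡ false → 0 < E p u → 0 < E′ p′ v → p ≡ p′
    disjoint p p′ c cp cp′ 0<u 0<v = ⊥-elim (produced-independent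
      (Factors⇒Q C (Produces C out) (mixture c E E′) (Factors-mixture C (Produces C out) E E′ c F F′)) adj
      (≤-trans (subst (λ b → 0 < (if b then E p else E′ p) u) (sym cp) 0<u) (part≤total (mixture c E E′) p u))
      (≤-trans (subst (λ b → 0 < (if b then E p′ else E′ p′) v) (sym cp′) 0<v) (part≤total (mixture c E E′) p′ v)))

-- Subsets given by decidable predicates and bounds on their size

∈-tabulate⁺ : ∀ {n} (χ : Fin n → Bool) {u} → χ u ≡ true → u ∈ tabulate χ
∈-tabulate⁺ χ {u} eq = lookup⇒[]= u _ (trans (lookup∘tabulate χ u) eq)

∈-tabulate⁻ : ∀ {n} (χ : Fin n → Bool) {u} → u ∈ tabulate χ → χ u ≡ true
∈-tabulate⁻ χ {u} u∈ = trans (sym (lookup∘tabulate χ u)) ([]=⇒lookup u∈)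

filterSubset : ∀ {n} {P : Fin n → Set} → (∀ u → Dec (P u)) → Subset n
filterSubset P? = tabulate (does ∘ P?)

module _ {n} {P : Fin n → Set} (P? : ∀ u → Dec (P u)) where

  ∈-filter⁺ : ∀ {u} → P u → u ∈ filterSubset P?
  ∈-filter⁺ {u} p = ∈-tabulate⁺ (does ∘ P?) (dec-true (P? u) p)

  ∈-filter⁻ : ∀ {u} → u ∈ filterSubset P? → P u
  ∈-filter⁻ {u} u∈ with P? u | ∈-tabulate⁻ (does ∘ P?) u∈
  ... | yes p | _ = p

∣p∣≡∑char : ∀ {n} (p : Subset n) → ∣ p ∣ ≡ sum (char p)
∣p∣≡∑char []          = refl
∣p∣≡∑char (true  ∷ p) = cong suc (∣p∣≡∑char p)
∣p∣≡∑char (false ∷ p) = ∣p∣≡∑char p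

∣p∣≤image : ∀ {m n} (f : Fin m → Fin n) (p : Subset n) → (∀ {u} → u ∈ p → ∃ λ x → f x ≡ u) → ∣ p ∣ ≤ m
∣p∣≤image {m} {n} f p hit = begin
  ∣ p ∣                              ≡⟨ ∣p∣≡∑char p ⟩
  sum (char p)                       ≤⟨ ∑-mono pointwise ⟩
  sum (λ u → sum (λ x → δ (f x) u))  ≡⟨ ∑-comm (λ u x → δ (f x) u) ⟩
  sum (λ x → sum (δ (f x)))
    ≡⟨ sum-cong-≗ (λ x → trans (sum-cong-≗ λ u → sym (*-identityʳ (δ (f x) u))) (dot-δˡ (f x) (λ _ → 1))) ⟩
  sum {m} (λ _ → 1)                  ≡⟨ trans (∑-const m 1) (*-identityʳ m) ⟩
  m                                  ∎
  where
  open ≤-Reasoning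
  pointwise : ∀ u → char p u ≤ sum (λ x → δ (f x) u)
  pointwise u with lookup p u in eq
  ... | false = z≤n
  ... | true  = let x , fx≡u = hit (lookup⇒[]= u p eq) in
    ≤-trans (≤-reflexive (sym (𝟙-yes (f x ≟ u) fx≡u))) (term≤∑ (λ x → δ (f x) u) x)

-- Hashes of suffixes and the first difference of two strings

state : ∀ {K} → Vec (Fin 8) K → Vec (Fin 2) K → Fin K → Fin 8
state (a ∷ v) (b ∷ s) zero    = hash (a ∷ v) (b ∷ s)
state (a ∷ v) (b ∷ s) (suc i) = state v s i

state-zero : ∀ {K} (v : Vec (Fin 8) (suc K)) s → state v s zero ≡ hash v s
state-zero (a ∷ v) (b ∷ s) = refl

state-step : ∀ {K} (v : Vec (Fin 8) K) s {i i′} → toℕ i′ ≡ suc (toℕ i) →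
             state v s i ≡ step (lookup v i) (lookup s i) (state v s i′)
state-step (a ∷ a′ ∷ v) (b ∷ b′ ∷ s) {zero}  {suc zero} eq = refl
state-step (a ∷ v)      (b ∷ s)      {suc i} {suc i′}   eq = state-step v s (suc-injective eq)

-- Taking the first difference ensures that at all earlier positions the chains of both strings make
-- the same transition.
first-difference : ∀ {m K} (s s′ : Vec (Fin m) K) → s ≢ s′ →
                   ∃ λ i → lookup s i ≢ lookup s′ i × (∀ i₀ → toℕ i₀ < toℕ i → lookup s i₀ ≡ lookup s′ i₀)
first-difference []      []        s≢s′ = contradiction refl s≢s′
first-difference (b ∷ s) (b′ ∷ s′) s≢s′ with b ≟ b′
... | no  b≢b′ = zero , b≢b′ , λ _ ()
... | yes refl =
  let i , differ , agree = first-difference s s′ (s≢s′ ∘ cong (b ∷_))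
  in suc i , differ , λ { zero _ → refl ; (suc i₀) (s≤s lt) → agree i₀ lt }

-- The graph and its path decomposition

-- The vertex inj₁ i is in the independent set of s iff the i-th bit of s is 1. The vertex
-- inj₂ ((j , i) , (x , b)) stands for: the j-th hash of the bits from i on is x, and bit i is b.
Vertex : ℕ → ℕ → Set
Vertex N K = Fin K ⊎ ((Fin N × Fin K) × (Fin 8 × Fin 2))

order : ℕ → ℕ → ℕ
order N K = K + N * K * (8 * 2)

vertex↔ : ∀ N K → Fin (order N K) ↔ Vertex N K
vertex↔ N K = (↔-id _ ⊎-↔ ((*↔× ×-↔ *↔×) ↔-∘ *↔×)) ↔-∘ +↔⊎

module HashGraph {N K : ℕ} (a : Fin N → Vec (Fin 8) K) where

  n = order N K

  abstract
    decode : Fin n → Vertex N K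
    decode = Inverse.to (vertex↔ N K)

    encode : Vertex N K → Fin n
    encode = Inverse.from (vertex↔ N K)

    decode-encode : ∀ v → decode (encode v) ≡ v
    decode-encode = Inverse.strictlyInverseˡ (vertex↔ N K)

    encode-decode : ∀ u → encode (decode u) ≡ u
    encode-decode = Inverse.strictlyInverseʳ (vertex↔ N K)

  -- The three kinds forbid a bit vertex together with bit 0 in any chain, two values at one
  -- position of a chain, and consecutive states that violate the transition. The orientation is
  -- removed in `graph`.
  data Edge : Vertex N K → Vertex N K → Set where
    hub    : ∀ {i j x} → Edge (inj₁ i) (inj₂ ((j , i) , (x , zero)))
    clique : ∀ {q y y′} → y ≢ y′ → Edge (inj₂ (q , y)) (inj₂ (q , y′))
    chain  : ∀ {j i i′ x x′ b b′} → toℕ i′ ≡ suc (toℕ i) → x ≢ step (lookup (a j) i) b x′ →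
             Edge (inj₂ ((j , i) , (x , b))) (inj₂ ((j , i′) , (x′ , b′)))

  Edge-irrefl : ∀ {v} → ¬ Edge v v
  Edge-irrefl (clique y≢y)  = y≢y refl
  Edge-irrefl (chain i≡1+i _) = 1+n≢n (sym i≡1+i)

  graph : Graph n
  graph .Adj u v         = Edge (decode u) (decode v) ⊎ Edge (decode v) (decode u)
  graph .symmetric u v   = [ inj₂ , inj₁ ]′
  graph .irrefl v        = [ Edge-irrefl , Edge-irrefl ]′

  edge⇒adj : ∀ {v w} → Edge v w → Adj graph (encode v) (encode w)
  edge⇒adj {v} {w} e = inj₁ (subst₂ Edge (sym (decode-encode v)) (sym (decode-encode w)) e)

  value : Vec (Fin 2) K → Fin N × Fin K → Fin 8 × Fin 2
  value s (j , i) = state (a j) s i , lookup s i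

  In : Vec (Fin 2) K → Vertex N K → Set
  In s (inj₁ i)       = lookup s i ≡ suc zero
  In s (inj₂ (q , y)) = y ≡ value s q

  In? : ∀ s v → Dec (In s v)
  In? s (inj₁ i)       = lookup s i ≟ suc zero
  In? s (inj₂ (q , y)) = ×.≡-dec _≟_ _≟_ y (value s q)

  In-independent : ∀ s {v w} → In s v → In s w → ¬ Edge v w
  In-independent s s≡1 eq hub with trans (sym s≡1) (sym (cong proj₂ eq))
  ... | ()
  In-independent s p p′ (clique y≢y′) = y≢y′ (trans p (sym p′))
  In-independent s refl refl (chain {j} i′≡1+i x≢) = x≢ (state-step (a j) s i′≡1+i)

  solution : Vec (Fin 2) K → Subset n
  solution s = filterSubset (In? s ∘ decode)

  solution-independent : ∀ s → Independent graph (solution s)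
  solution-independent s u v u∈ v∈ = [ In-independent s p q , In-independent s q p ]′
    where
    p = ∈-filter⁻ (In? s ∘ decode) u∈
    q = ∈-filter⁻ (In? s ∘ decode) v∈

  In⇒∈ : ∀ s {v} → In s v → encode v ∈ solution s
  In⇒∈ s {v} p = ∈-filter⁺ (In? s ∘ decode) (subst (In s) (sym (decode-encode v)) p)

  position : Fin N × Fin K → ℕ
  position (j , i) = toℕ (combine j i)

  -- All chains are laid end to end. A bag holds every hub and a window of two consecutive cliques,
  -- which may straddle two chains.
  InBag : Fin (N * K) → Vertex N K → Set
  InBag t (inj₁ i)       = ⊤
  InBag t (inj₂ (q , y)) = toℕ t ≤ position q × position q ≤ suc (toℕ t)

  InBag? : ∀ t v → Dec (InBag t v)
  InBag? t (inj₁ i)       = yes tt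
  InBag? t (inj₂ (q , y)) = (toℕ t ≤? position q) ×-dec (position q ≤? suc (toℕ t))

  edge-covered : ∀ {v w} → Edge v w → ∃ λ t → InBag t v × InBag t w
  edge-covered (hub {i} {j})           = combine j i , tt , ≤-refl , n≤1+n _
  edge-covered (clique {j , i} _)      = combine j i , (≤-refl , n≤1+n _) , (≤-refl , n≤1+n _)
  edge-covered (chain {j} {i} {i′} eq _) =
    combine j i , (≤-refl , n≤1+n _) , (≤-trans (n≤1+n _) (≤-reflexive (sym next)) , ≤-reflexive next)
    where
    next : toℕ (combine j i′) ≡ suc (toℕ (combine j i))
    next = begin
      toℕ (combine j i′)          ≡⟨ toℕ-combine j i′ ⟩
      K * toℕ j + toℕ i′          ≡⟨ cong (K * toℕ j +_) eq ⟩
      K * toℕ j + suc (toℕ i)     ≡⟨ +-suc _ _ ⟩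
      suc (K * toℕ j + toℕ i)     ≡⟨ cong suc (sym (toℕ-combine j i)) ⟩
      suc (toℕ (combine j i))     ∎
      where open ≡-Reasoning

  InBag-contiguous : ∀ v {i j l} → toℕ i ≤ toℕ j → toℕ j ≤ toℕ l → InBag i v → InBag l v → InBag j v
  InBag-contiguous (inj₁ _) _ _ _ _ = tt
  InBag-contiguous (inj₂ _) i≤j j≤l (_ , q≤1+i) (l≤q , _) = ≤-trans j≤l l≤q , ≤-trans q≤1+i (s≤s i≤j)

  decomposition : PathDecomposition graph
  decomposition .len   = N * K
  decomposition .bag t = filterSubset (InBag? t ∘ decode)
  decomposition .edgesCovered u v (inj₁ e) =
    let t , p , q = edge-covered e in t , ∈-filter⁺ (InBag? t ∘ decode) p , ∈-filter⁺ (InBag? t ∘ decode) q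
  decomposition .edgesCovered u v (inj₂ e) =
    let t , q , p = edge-covered e in t , ∈-filter⁺ (InBag? t ∘ decode) p , ∈-filter⁺ (InBag? t ∘ decode) q
  decomposition .contiguous v i j l i≤j j≤l v∈i v∈l = ∈-filter⁺ (InBag? j ∘ decode)
    (InBag-contiguous (decode v) {i} {j} {l} i≤j j≤l
      (∈-filter⁻ (InBag? i ∘ decode) v∈i) (∈-filter⁻ (InBag? l ∘ decode) v∈l))

  BagIndex : Set
  BagIndex = Fin K ⊎ (Fin 2 × (Fin 8 × Fin 2))

  bagIndex↔ : Fin (K + 2 * (8 * 2)) ↔ BagIndex
  bagIndex↔ = (↔-id _ ⊎-↔ ((↔-id _ ×-↔ *↔×) ↔-∘ *↔×)) ↔-∘ +↔⊎

  next : Fin (N * K) → Fin (N * K)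
  next t with suc (toℕ t) <? N * K
  ... | yes lt = fromℕ< lt
  -- Default at the last position, whose window has a single clique. Repetition is harmless, as only
  -- a surjection onto the bag is needed.
  ... | no  _  = t

  next-suc : ∀ t t′ → toℕ t′ ≡ suc (toℕ t) → next t ≡ t′
  next-suc t t′ eq with suc (toℕ t) <? N * K
  ... | yes lt = toℕ-injective (trans (toℕ-fromℕ< lt) (sym eq))
  ... | no ≮   = contradiction (subst (_< N * K) eq (toℕ<n t′)) ≮

  bagVertex : Fin (N * K) → BagIndex → Vertex N K
  bagVertex t (inj₁ i)           = inj₁ i
  bagVertex t (inj₂ (zero , y))  = inj₂ (remQuot K t , y)
  bagVertex t (inj₂ (suc _ , y)) = inj₂ (remQuot K (next t) , y)

  bagVertex-onto : ∀ t v → InBag t v → ∃ λ x → bagVertex t x ≡ v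
  bagVertex-onto t (inj₁ i) _ = inj₁ i , refl
  bagVertex-onto t (inj₂ ((j , i) , y)) (t≤q , q≤1+t) with m≤n⇒m<n∨m≡n q≤1+t
  ... | inj₁ (s≤s q≤t) = inj₂ (zero , y) , cong (λ q → inj₂ (q , y))
        (trans (cong (remQuot K) (toℕ-injective (≤-antisym t≤q q≤t))) (remQuot-combine j i))
  ... | inj₂ q≡1+t = inj₂ (suc zero , y) , cong (λ q → inj₂ (q , y))
        (trans (cong (remQuot K) (next-suc t (combine j i) q≡1+t)) (remQuot-combine j i))

  -- There are K hubs and at most two cliques of 8 * 2 vertices. A bag of size k + 1 therefore
  -- leaves room for k - 31 hubs.
  bag-size : ∀ t → ∣ bag decomposition t ∣ ≤ K + 2 * (8 * 2)
  bag-size t = ∣p∣≤image (encode ∘ bagVertex t ∘ Inverse.to bagIndex↔) (bag decomposition t) hit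
    where
    hit : ∀ {u} → u ∈ bag decomposition t → ∃ λ x → encode (bagVertex t (Inverse.to bagIndex↔ x)) ≡ u
    hit {u} u∈ =
      let x , eq = bagVertex-onto t (decode u) (∈-filter⁻ (InBag? t ∘ decode) u∈)
      in Inverse.from bagIndex↔ x ,
         trans (cong (encode ∘ bagVertex t) (Inverse.strictlyInverseˡ bagIndex↔ x))
               (trans (cong encode eq) (encode-decode u))

-- The lower bound

bits : ∀ K → Fin (2 ^ K) → Vec (Fin 2) K
bits zero    _ = []
bits (suc K) x = proj₁ (remQuot {2} (2 ^ K) x) ∷ bits K (proj₂ (remQuot {2} (2 ^ K) x))

bits-injective : ∀ K {x y} → bits K x ≡ bits K y → x ≡ y
bits-injective zero    {zero} {zero} _ = refl
bits-injective (suc K) {x} {y} eq = begin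
  x                                                    ≡⟨ sym (combine-remQuot {2} (2 ^ K) x) ⟩
  combine (proj₁ (remQuot {2} (2 ^ K) x)) (proj₂ (remQuot {2} (2 ^ K) x))
    ≡⟨ cong₂ combine (cong head eq) (bits-injective K (cong tail eq)) ⟩
  combine (proj₁ (remQuot {2} (2 ^ K) y)) (proj₂ (remQuot {2} (2 ^ K) y))
    ≡⟨ combine-remQuot {2} (2 ^ K) y ⟩
  y                                                    ∎
  where
  open ≡-Reasoning

module LowerBound {N K : ℕ} (2≤N : 2 ≤ N) (a : Fin N → Vec (Fin 8) (suc K))
                  (few : ∀ {s s′} → s ≢ s′ → 2 * sum (λ j → collides (a j) s s′) < N)
                  {S} (C : Circuit (order N (suc K)) S) (out : Fin S)
                  (calc : Calculates (HashGraph.graph a) C out) where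

  open HashGraph a
  open Calculating {G = graph} C out calc
  open Certificate

  node : Vec (Fin 2) (suc K) → Fin N → Fin (suc K) → Fin n
  node s j i = encode (inj₂ ((j , i) , value s (j , i)))

  final : Vec (Fin 2) (suc K) → Fin N → Fin n
  final s j = node s j zero

  node∈ : ∀ s j i → node s j i ∈ solution s
  node∈ s j i = In⇒∈ s refl

  final-injective : ∀ s j j′ → final s j ≡ final s j′ → j ≡ j′
  final-injective s j j′ eq = position-inj (trans (sym (decode-encode _)) (trans (cong decode eq) (decode-encode _)))
    where
    position-inj : ∀ {i i′ y y′} → _≡_ {A = Vertex N (suc K)} (inj₂ ((j , i) , y)) (inj₂ ((j′ , i′) , y′)) → j ≡ j′
    position-inj refl = refl

  -- All hashes on which s and s′ differ end in the same part as the hub of their first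
  -- difference i, since differing hash values propagate along adjacent vertices down to i.
  module Separation {s s′ g} (c : Certificate (final s) (solution s) g) (c′ : Certificate (final s′) (solution s′) g)
                    i (s≡1 : lookup s i ≡ suc zero) (s′≡0 : lookup s′ i ≡ zero)
                    (agree : ∀ i₀ → toℕ i₀ < toℕ i → lookup s i₀ ≡ lookup s′ i₀) where

    same-part : ∀ {v w} → Adj graph v w → ∀ p p′ → 0 < part c p v → 0 < part c′ p′ w → p ≡ p′
    same-part = adjacent⇒same-part {E = part c} {part c′} (factors c) (factors c′)

    -- Some part of `c′` contains `w`, and adjacency to `v` forces it to be `p`. The mirror image is
    -- `pull`.
    push : ∀ {v w p} → Adj graph v w → w ∈ solution s′ → 0 < part c p v → 0 < part c′ p w
    push {w = w} {p} adj w∈ 0<v = let p′ , 0<w = covers c′ w∈ in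
      subst (λ p → 0 < part c′ p w) (sym (same-part adj p p′ 0<v 0<w)) 0<w

    pull : ∀ {v w p} → Adj graph v w → v ∈ solution s → 0 < part c′ p w → 0 < part c p v
    pull {v} {p = p} adj v∈ 0<w = let p′ , 0<v = covers c v∈ in
      subst (λ p → 0 < part c p v) (same-part adj p′ p 0<v 0<w) 0<v

    hub-covered : ∃ λ p → 0 < part c p (encode (inj₁ i))
    hub-covered = covers c (In⇒∈ s s≡1)

    p : Part
    p = proj₁ hub-covered

    -- Bit i of `s′` is 0, so the hub is adjacent to the vertex of `s′` at position i of every
    -- chain, which thus lies in `p`. The clique edge carries `p` back to the vertex of `s`.
    start : ∀ j {i₀} → i₀ ≡ i → 0 < part c p (node s j i₀) × 0 < part c′ p (node s′ j i₀)
    start j refl = pull clique-adj (node∈ s j i) 0<s′ , 0<s′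
      where
      differ : value s (j , i) ≢ value s′ (j , i)
      differ eq with trans (sym s≡1) (trans (cong proj₂ eq) s′≡0)
      ... | ()
      clique-adj : Adj graph (node s j i) (node s′ j i)
      clique-adj = edge⇒adj (clique differ)
      hub-adj : Adj graph (encode (inj₁ i)) (node s′ j i)
      hub-adj = edge⇒adj (subst (λ b → Edge (inj₁ i) (inj₂ ((j , i) , (state (a j) s′ i , b)))) (sym s′≡0) hub)
      0<s′ : 0 < part c′ p (node s′ j i)
      0<s′ = push hub-adj (node∈ s′ j i) (proj₂ hub-covered)

    -- Under equal bits, different states at one position stem from different states at the next.
    -- The vertex of either string is then adjacent to the next vertex of the other, because that
    -- transition is wrong; the part passes along these crossing edges. The induction is on the
    -- distance d to i.
    propagate : ∀ j d i₀ → toℕ i₀ + d ≡ toℕ i → state (a j) s i₀ ≢ state (a j) s′ i₀ →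
                0 < part c p (node s j i₀) × 0 < part c′ p (node s′ j i₀)
    propagate j zero i₀ eq _ = start j (toℕ-injective (trans (sym (+-identityʳ _)) eq))
    propagate j (suc d) i₀ eq differ =
      pull (edge⇒adj (chain next≡ forward)) (node∈ s j i₀) (proj₂ IH) ,
      push (symmetric graph (node s′ j i₀) (node s j i₁) (edge⇒adj (chain next≡ backward))) (node∈ s′ j i₀) (proj₁ IH)
      where
      i₀<i : toℕ i₀ < toℕ i
      i₀<i = subst (toℕ i₀ <_) eq (m<m+n (toℕ i₀) (s≤s z≤n))
      next<K : suc (toℕ i₀) < suc K
      next<K = ≤-<-trans i₀<i (toℕ<n i)
      i₁ : Fin (suc K)
      i₁ = fromℕ< next<K
      next≡ : toℕ i₁ ≡ suc (toℕ i₀)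
      next≡ = toℕ-fromℕ< next<K
      b≡b′ = agree i₀ i₀<i
      s-step : state (a j) s i₀ ≡ step (lookup (a j) i₀) (lookup s i₀) (state (a j) s i₁)
      s-step = state-step (a j) s next≡
      s′-step : state (a j) s′ i₀ ≡ step (lookup (a j) i₀) (lookup s′ i₀) (state (a j) s′ i₁)
      s′-step = state-step (a j) s′ next≡
      forward : state (a j) s i₀ ≢ step (lookup (a j) i₀) (lookup s i₀) (state (a j) s′ i₁)
      forward eq = differ (trans eq
        (trans (cong (λ b → step (lookup (a j) i₀) b (state (a j) s′ i₁)) b≡b′) (sym s′-step)))
      backward : state (a j) s′ i₀ ≢ step (lookup (a j) i₀) (lookup s′ i₀) (state (a j) s i₁)
      backward eq = differ (sym (trans eq
        (trans (cong (λ b → step (lookup (a j) i₀) b (state (a j) s i₁)) (sym b≡b′)) (sym s-step))))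
      IH = propagate j d i₁ (trans (cong (_+ d) next≡) (trans (sym (+-suc (toℕ i₀) d)) eq))
             (λ same → differ (trans s-step (trans (cong₂ (step (lookup (a j) i₀)) b≡b′ same) (sym s′-step))))

    -- Every chain either collides or has its final vertex in `p`, so N ≤ A + M. But 2 * A < N by
    -- the choice of hashes, and 2 * M ≤ N because `p` is light.
    contradictory : ⊥
    contradictory = <-irrefl refl (begin-strict
      N + N                          ≤⟨ +-mono-≤ N≤ N≤ ⟩
      (A + M) + (A + M)              ≡⟨ rearrange A M ⟩
      2 * A + 2 * M                  <⟨ +-mono-<-≤ (few s≢s′) (light c p) ⟩
      N + N                          ∎)
      where
      open ≤-Reasoning
      A = sum (λ j → collides (a j) s s′)
      M = share (final s) (part c p)
      s≢s′ : s ≢ s′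
      s≢s′ refl with trans (sym s≡1) s′≡0
      ... | ()
      rearrange : ∀ x y → (x + y) + (x + y) ≡ 2 * x + 2 * y
      rearrange = solve-∀
      each : ∀ j → 1 ≤ collides (a j) s s′ + part c p (final s j)
      each j with hash (a j) s ≟ hash (a j) s′
      ... | yes _ = s≤s z≤n
      ... | no differ = proj₁ (propagate j (toℕ i) zero refl
              (λ same → differ (trans (sym (state-zero (a j) s)) (trans same (state-zero (a j) s′)))))
      N≤ : N ≤ A + M
      N≤ = begin
        N                ≡⟨ sym (trans (∑-const N 1) (*-identityʳ N)) ⟩
        sum {N} (λ _ → 1) ≤⟨ ∑-mono each ⟩
        sum (λ j → collides (a j) s s′ + part c p (final s j)) ≡⟨ ∑-distrib-+ (λ j → collides (a j) s s′) _ ⟩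
        A + M            ∎

  certified : ∀ s → ∃ (Certificate (final s) (solution s))
  certified s =
    certificate (final s) (final-injective s) 2≤N (solution s) (solution-independent s) (λ j → node∈ s j zero)

  gate : Vec (Fin 2) (suc K) → Fin S
  gate = proj₁ ∘ certified

  same-gate : ∀ {s s′ g} → Certificate (final s) (solution s) g → Certificate (final s′) (solution s′) g → s ≡ s′
  same-gate {s} {s′} c c′ with s ≟ᵛ s′
  ... | yes s≡s′ = s≡s′
  ... | no  s≢s′ with first-difference s s′ s≢s′
  ... | i , differ , agree with lookup s i in sᵢ | lookup s′ i in s′ᵢ
  ... | zero     | zero     = contradiction refl differ
  ... | suc zero | suc zero = contradiction refl differ
  -- The string with bit 1 at the first difference contains the hub and takes the first role.
  ... | suc zero | zero     = ⊥-elim (Separation.contradictory c c′ i sᵢ s′ᵢ agree)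
  ... | zero     | suc zero = ⊥-elim (Separation.contradictory c′ c i s′ᵢ sᵢ (λ i₀ lt → sym (agree i₀ lt)))

  gate-injective : ∀ s s′ → gate s ≡ gate s′ → s ≡ s′
  gate-injective s s′ eq =
    same-gate (subst (Certificate (final s) (solution s)) eq (proj₂ (certified s))) (proj₂ (certified s′))

  size-bound : 2 ^ suc K ≤ S
  size-bound = injective⇒≤ {f = gate ∘ bits (suc K)} (λ eq → bits-injective (suc K) (gate-injective _ _ eq))

-- Vertex count and choice of parameters

order-bound : ∀ K → order (numHashes (suc K)) (suc K) ≤ (31 + suc K) ^ 4
order-bound K = begin
  order (numHashes L) L      ≡⟨ expand L ⟩
  L * 17 + L * L * 64        ≤⟨ +-monoˡ-≤ _ (*-monoˡ-≤ 17 (m≤m*n L L)) ⟩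
  L * L * 17 + L * L * 64    ≡⟨ sym (*-distribˡ-+ (L * L) 17 64) ⟩
  -- The constant 81 is absorbed by 31 * 31.
  L * L * 81                 ≤⟨ *-mono-≤ (*-mono-≤ (m≤n+m L 31) (m≤n+m L 31))
                                         (≤-trans (m≤m+n 81 _) (*-mono-≤ (m≤m+n 31 L) (m≤m+n 31 L))) ⟩
  k * k * (k * k)            ≡⟨ power k ⟩
  k ^ 4                      ∎
  where
  open ≤-Reasoning
  L = suc K
  k = 31 + L
  expand : ∀ L → L + (4 * L + 1) * L * (8 * 2) ≡ L * 17 + L * L * 64
  expand = solve-∀
  power : ∀ k → k * k * (k * k) ≡ k * (k * (k * (k * 1)))
  power = solve-∀

empty : Graph 0
empty .Adj ()
empty .symmetric ()
empty .irrefl ()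

empty-pathwidth : ∀ k → PathwidthAtMost empty k
empty-pathwidth k = record { len = 0 ; bag = λ () ; edgesCovered = λ () ; contiguous = λ () } , λ ()

^-split : ∀ m {n k d} → m + n ≡ k → 2 ^ m ≡ d → 2 ^ k ≡ d * 2 ^ n
^-split m {n} refl refl = ^-distribˡ-+-* 2 m n

module HardGraph (K : ℕ) where

  a = proj₁ (hash-family (suc K))

  few : ∀ {s s′} → s ≢ s′ → 2 * sum (λ j → collides (a j) s s′) < numHashes (suc K)
  few = proj₂ (hash-family (suc K))

  open HashGraph a public

  pathwidth : ∀ {k} → suc K + 2 * (8 * 2) ≤ suc k → PathwidthAtMost graph k
  pathwidth size≤ = decomposition , λ t → ≤-trans (bag-size t) size≤

  size-bound : ∀ {s} (C : Circuit n s) out → Calculates graph C out → 2 ^ suc K ≤ s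
  size-bound = LowerBound.size-bound (+-monoˡ-≤ 1 {1} (s≤s z≤n)) a few

-- The scale d = 2 ^ 31 is kept abstract, because 2 ^ 31 * s would be unfolded in unary.
hard-graph : ∀ d → 2 ^ 31 ≡ d → ∀ k → Σ ℕ λ n → n ≤ k ^ 4 × Σ (Graph n) λ G → PathwidthAtMost G k ×
             (∀ {s} (C : Circuit n s) (out : Fin s) → Calculates G C out → 2 ^ k ≤ d * s)
hard-graph d 2^31≡d k with k ≤? 31
-- For small k the graph without vertices suffices: 2 ^ k ≤ d, and a circuit with an output node has
-- s ≥ 1.
... | yes k≤31 = 0 , z≤n , empty , empty-pathwidth k , λ {s} C out _ →
      ≤-trans (≤-trans (^-monoʳ-≤ 2 k≤31) (≤-reflexive 2^31≡d)) (m≤m*n d s {{nonZeroIndex out}})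
... | no k≰31 = order (numHashes (suc K)) (suc K) ,
      subst (λ k → order (numHashes (suc K)) (suc K) ≤ k ^ 4) eq (order-bound K) ,
      graph , pathwidth (≤-reflexive (trans (+-comm (suc K) 32) (cong suc eq))) , λ {s} C out calc →
      ≤-trans (≤-reflexive (^-split 31 eq 2^31≡d)) (*-monoʳ-≤ d (size-bound C out calc))
  where
  -- Here K = k - 32, so there are `suc K` = k - 31 hubs and at least one of them.
  split = m≤n⇒∃[o]m+o≡n (≰⇒> k≰31)
  K = proj₁ split
  open HardGraph K
  eq : 31 + suc K ≡ k
  eq = trans (+-suc 31 K) (proj₂ split)

theorem1p1 : Σ ℕ λ c → 1 ≤ c × Σ ℕ λ d → 1 ≤ d ×
    (∀ k → 1 ≤ k → Σ ℕ λ n → n ≤ k ^ c × Σ (Graph n) λ G → PathwidthAtMost G k ×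
    (∀ {s} (C : Circuit n s) (out : Fin s) → Calculates G C out → 2 ^ k ≤ d * s))
theorem1p1 = 4 , s≤s z≤n , 2 ^ 31 , m^n>0 2 31 , λ k _ → hard-graph (2 ^ 31) refl k
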